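{- Let $A$ be a finite alphabet with at least two distinct letters and let $\{x_1,\ldots,x_n\}$ and $\{y_1,\ldots,y_m\}$ be disjoint sets of variables. Deciding the Inclusion of Pattern Languages problem for $\alpha\in (A\cup \{x_1,\ldots,x_n\})^*$ and $\beta\in (A\cup \{y_1,\ldots,y_m\})^*$, i.e. deciding whether $L(\alpha)\subseteq L(\beta)$, can be reduced to deciding whether the following formula holds or not in $A^*$: \[\exists x_1,\ldots,x_n.\ \forall y_1,\ldots,y_m.\ \alpha \neq \beta.\]
   Context: A pattern is a word over constants from $A$ and variables (disjoint from $A$). A substitution is a morphism $h$ from words over constants and variables to $A^*$ with $h(a)=a$ for all $a\in A$. The pattern language of $\alpha$ is $L(\alpha)=\{h(\alpha)\mid h\text{ is a substitution}\}$ (variables may be replaced by the empty word). In the formula, variables range over $A^*$, and $\alpha\ne\beta$ is satisfied by an assignment if the corresponding substitution $h$ has $h(\alpha)\neq h(\beta)$. -}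

module Defs where

open import Algebra.Morphism.Structures using (module MonoidMorphisms)
open import Data.Fin.Base using (Fin; _↑ˡ_; _↑ʳ_)
open import Data.List.Base using (List; []; [_]; _++_; concatMap; map; ++-[]-rawMonoid)
open import Data.List.Properties using (concatMap-++)
open import Data.Nat.Base using (ℕ; zero; suc; _+_)
open import Data.Product.Base using (Σ-syntax; ∃-syntax; _×_)
open import Data.Sum.Base using (_⊎_; inj₁; inj₂; [_,_]′; map₂)
open import Data.Vec.Base using (Vec; []; _∷_; lookup)
open import Level using (0ℓ)
open import Relation.Binary.PropositionalEquality using (_≡_; refl; cong)
open import Relation.Nullary.Negation using (¬_)
open import Relation.Unary using (Pred)

Word : Set → Set
Word A = List A

Pattern : Set → ℕ → Set
Pattern A n = List (A ⊎ Fin n)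

rename : ∀ {A n k} → (Fin n → Fin k) → Pattern A n → Pattern A k
rename f = map (map₂ f)

record Substitution (A : Set) (n : ℕ) : Set where
  open MonoidMorphisms (++-[]-rawMonoid (A ⊎ Fin n)) (++-[]-rawMonoid A)
  field
    apply          : Pattern A n → Word A
    isHomomorphism : IsMonoidHomomorphism apply
    fixesConstants : ∀ a → apply [ inj₁ a ] ≡ [ a ]

open Substitution public using (apply)

L : ∀ {A n} → Pattern A n → Pred (Word A) 0ℓ
L {A} {n} α w = Σ[ h ∈ Substitution A n ] apply h α ≡ w

-- The substitution determined by an assignment of words to the variables.
toSubstitution : ∀ {A n} → Vec (Word A) n → Substitution A n
toSubstitution {A} {n} ρ = record
  { apply          = concatMap letter
  ; isHomomorphism = record
    { isMagmaHomomorphism = record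
      { isRelHomomorphism = record { cong = cong (concatMap letter) }
      ; homo              = concatMap-++ letter
      }
    ; ε-homo = refl
    }
  ; fixesConstants = λ _ → refl
  }
  where
  letter : A ⊎ Fin n → Word A
  letter = [ [_] , lookup ρ ]′

infix  7 _≐_
infix  6 ~_
infixr 5 _∧′_
infixr 4 _∨′_

-- First-order formulas over word equations with constants from A. Variables
-- are de Bruijn indices: a quantifier binds index zero of its body.
data Formula (A : Set) : ℕ → Set where
  _≐_       : ∀ {n} → Pattern A n → Pattern A n → Formula A n
  ~_        : ∀ {n} → Formula A n → Formula A n
  _∧′_ _∨′_ : ∀ {n} → Formula A n → Formula A n → Formula A n
  ∃′ ∀′     : ∀ {n} → Formula A (suc n) → Formula A n

infix 3 _⊨_

_⊨_ : ∀ {A n} → Vec (Word A) n → Formula A n → Set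
ρ ⊨ u ≐ v  = apply (toSubstitution ρ) u ≡ apply (toSubstitution ρ) v
ρ ⊨ ~ φ    = ¬ (ρ ⊨ φ)
ρ ⊨ φ ∧′ ψ = (ρ ⊨ φ) × (ρ ⊨ ψ)
ρ ⊨ φ ∨′ ψ = (ρ ⊨ φ) ⊎ (ρ ⊨ ψ)
ρ ⊨ ∃′ φ   = ∃[ w ] (w ∷ ρ ⊨ φ)
ρ ⊨ ∀′ φ   = ∀ w → (w ∷ ρ ⊨ φ)

Sentence : Set → Set
Sentence A = Formula A 0

Holds : ∀ {A} → Sentence A → Set
Holds φ = [] ⊨ φ

∃* : ∀ {A} n → Formula A n → Sentence A
∃* zero    φ = φ
∃* (suc n) φ = ∃* n (∃′ φ)

∀* : ∀ {A n} m → Formula A (m + n) → Formula A n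
∀* zero    φ = φ
∀* (suc m) φ = ∀* m (∀′ φ)

-- ∃ x₁ … xₙ. ∀ y₁ … yₘ. α ≠ β. In the matrix, the first m indices are the
-- y's and the remaining n are the x's, so the two families are disjoint.
inclusionSentence : ∀ {A n m} → Pattern A n → Pattern A m → Sentence A
inclusionSentence {n = n} {m} α β =
  ∃* n (∀* m (~ (rename (m ↑ʳ_) α ≐ rename (_↑ˡ n) β)))

{-# OPTIONS --safe #-}

-- The sentence says that some word of L(α) lies outside L(β). Constructively,
-- recovering L(α) ⊆ L(β) from its negation needs membership in L(β) to be
-- decidable. It is: truncating all values of an assignment to length |w| does
-- not affect whether β is sent to w, since a variable that occurs in β already
-- has a value no longer than w. So finitely many assignments need be tried.
module Submission where

open import Defs
open import Algebra.Morphism.Structures using (module MonoidMorphisms)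
open import Data.Fin.Base using (Fin; _↑ˡ_; _↑ʳ_)
open import Data.Fin.Properties using (any?) renaming (_≟_ to _≟ᶠ_)
open import Data.List.Base using (List; []; _∷_; [_]; _++_; length; take)
open import Data.List.Properties using (≡-dec; length-++; take-all; length-take)
open import Data.Nat.Base using (ℕ; zero; suc; _+_; _≤_; z≤n; s≤s)
open import Data.Nat.Properties using (≤-trans; ≤-reflexive; m≤m+n; m≤n+m; m⊓n≤m)
open import Data.Product.Base using (∃; ∃₂; ∃-syntax; _×_; _,_)
open import Data.Sum.Base using (inj₁; inj₂; [_,_]′)
open import Data.Vec.Base as Vec using (Vec; []; _∷_; lookup; tabulate)
open import Data.Vec.Properties using (lookup-map; lookup∘tabulate; lookup-++ˡ; lookup-++ʳ)
open import Data.Vec.Relation.Unary.All using (All; []; _∷_)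
open import Data.Vec.Relation.Unary.All.Properties using (map⁺)
import Data.Vec.Relation.Unary.All as All
open import Function.Base using (_∘_)
open import Function.Bundles using (_↔_; _⇔_; mk⇔; module Inverse; module Equivalence)
open import Function.Properties.Inverse using (↔⇒↣)
open import Relation.Binary.Definitions using (DecidableEquality)
open import Relation.Binary.PropositionalEquality
  using (_≡_; _≢_; refl; sym; trans; cong; cong₂; subst)
open import Relation.Nullary using (¬_; Dec)
open import Relation.Nullary.Decidable using (map′; _⊎-dec_; ¬?; via-injection; decidable-stable)
open import Relation.Unary using (Decidable; _⊆_)

private variable
  A : Set
  n m : ℕ

eval : Vec (Word A) n → Pattern A n → Word A
eval ρ = apply (toSubstitution ρ)

-- Only the values of `σ` on the image of `f` are constrained, so one joint assignment can serve
-- both variable families, each seen through its own embedding.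
eval-rename : (f : Fin n → Fin m) (σ : Vec (Word A) m) (ρ : Vec (Word A) n) →
              (∀ i → lookup σ (f i) ≡ lookup ρ i) →
              ∀ α → eval σ (rename f α) ≡ eval ρ α
eval-rename f σ ρ σf≗ρ []           = refl
eval-rename f σ ρ σf≗ρ (inj₁ a ∷ α) = cong (a ∷_) (eval-rename f σ ρ σf≗ρ α)
eval-rename f σ ρ σf≗ρ (inj₂ i ∷ α) = cong₂ _++_ (σf≗ρ i) (eval-rename f σ ρ σf≗ρ α)

assignment : Substitution A n → Vec (Word A) n
assignment h = tabulate λ i → apply h [ inj₂ i ]

-- Words form a free monoid, so a morphism is determined by its values on single symbols. Constants
-- are fixed, which leaves the values on the variables. Hence quantifying over morphisms amounts to
-- quantifying over vectors of words.
eval-assignment : (h : Substitution A n) → ∀ α → eval (assignment h) α ≡ apply h α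
eval-assignment {A} {n} h = go
  where
  open Substitution h using (isHomomorphism; fixesConstants)
  open MonoidMorphisms.IsMonoidHomomorphism isHomomorphism using (homo; ε-homo)

  go : ∀ α → eval (assignment h) α ≡ apply h α
  go []           = sym ε-homo
  go (inj₁ a ∷ α) = trans (cong₂ _++_ (sym (fixesConstants a)) (go α)) (sym (homo [ inj₁ a ] α))
  go (inj₂ i ∷ α) = trans (cong₂ _++_ (lookup∘tabulate _ i) (go α)) (sym (homo [ inj₂ i ] α))

∈L⇔eval : (α : Pattern A n) {w : Word A} → L α w ⇔ (∃[ ρ ] eval ρ α ≡ w)
∈L⇔eval α = mk⇔
  (λ (h , hα≡w) → assignment h , trans (eval-assignment h α) hα≡w)
  (λ (ρ , ρα≡w) → toSubstitution ρ , ρα≡w)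

∃*⇔ : ∀ n (φ : Formula A n) → Holds (∃* n φ) ⇔ (∃[ ρ ] (ρ ⊨ φ))
∃*⇔ zero    φ = mk⇔ (λ p → [] , p) λ where ([] , p) → p
∃*⇔ (suc n) φ = mk⇔
  -- The quantifier nearest the matrix binds index zero, so the head `w` is chosen last, after all
  -- of `ρ`.
  (λ p → let ρ , w , q = Equivalence.to (∃*⇔ n (∃′ φ)) p in w ∷ ρ , q)
  (λ where (w ∷ ρ , q) → Equivalence.from (∃*⇔ n (∃′ φ)) (ρ , w , q))

∀*⇔ : ∀ m (φ : Formula A (m + n)) {ρ : Vec (Word A) n} →
      (ρ ⊨ ∀* m φ) ⇔ (∀ σ → σ Vec.++ ρ ⊨ φ)
∀*⇔ zero    φ = mk⇔ (λ where p [] → p) (λ p → p [])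
∀*⇔ (suc m) φ = mk⇔
  (λ where p (w ∷ σ) → Equivalence.to (∀*⇔ m (∀′ φ)) p σ w)
  (λ p → Equivalence.from (∀*⇔ m (∀′ φ)) λ σ w → p (w ∷ σ))

inclusionSentence⇔ : (α : Pattern A n) (β : Pattern A m) →
  Holds (inclusionSentence α β) ⇔ (∃[ ρ ] ∀ σ → eval ρ α ≢ eval σ β)
inclusionSentence⇔ {n = n} {m = m} α β = mk⇔
  (λ p → let ρ , q = Equivalence.to (∃*⇔ n (∀* m α≢β)) p in
    ρ , λ σ eq → Equivalence.to (∀*⇔ m α≢β) q σ (trans (evalʳ σ ρ) (trans eq (sym (evalˡ σ ρ)))))
  (λ (ρ , q) → Equivalence.from (∃*⇔ n (∀* m α≢β)) (ρ , Equivalence.from (∀*⇔ m α≢β) λ σ eq →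
    q σ (trans (sym (evalʳ σ ρ)) (trans eq (evalˡ σ ρ)))))
  where
  α≢β : Formula _ (m + n)
  α≢β = ~ (rename (m ↑ʳ_) α ≐ rename (_↑ˡ n) β)

  evalʳ : ∀ σ ρ → eval (σ Vec.++ ρ) (rename (m ↑ʳ_) α) ≡ eval ρ α
  evalʳ σ ρ = eval-rename (m ↑ʳ_) (σ Vec.++ ρ) ρ (lookup-++ʳ σ ρ) α

  evalˡ : ∀ σ ρ → eval (σ Vec.++ ρ) (rename (_↑ˡ n) β) ≡ eval σ β
  evalˡ σ ρ = eval-rename (_↑ˡ n) (σ Vec.++ ρ) σ (lookup-++ˡ σ ρ) β

truncate : ℕ → Vec (Word A) n → Vec (Word A) n
truncate N = Vec.map (take N)

-- The value of an occurring variable is a factor of `eval ρ α`, so it has length at most `N` and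
-- `take N` leaves it alone. Other variables may be cut, but they are never looked up.
eval-truncate : ∀ N (ρ : Vec (Word A) n) α → length (eval ρ α) ≤ N →
                eval (truncate N ρ) α ≡ eval ρ α
eval-truncate N ρ []           _ = refl
eval-truncate N ρ (inj₁ a ∷ α) l =
  cong (a ∷_) (eval-truncate N ρ α (≤-trans (m≤n+m _ 1) l))
eval-truncate N ρ (inj₂ i ∷ α) l = cong₂ _++_
  (trans (lookup-map i (take N) ρ) (take-all N _ (≤-trans (m≤m+n _ _) l′)))
  (eval-truncate N ρ α (≤-trans (m≤n+m _ _) l′))
  where l′ = subst (_≤ N) (length-++ (lookup ρ i)) l

Short : ℕ → Word A → Set
Short N w = length w ≤ N

truncate-short : ∀ N (ρ : Vec (Word A) n) → All (Short N) (truncate N ρ)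
truncate-short N ρ = map⁺ (All.universal short ρ)
  where
  short : ∀ w → length (take N w) ≤ N
  short w = ≤-trans (≤-reflexive (length-take N w)) (m⊓n≤m N (length w))

module _ {k : ℕ} (A↔Fin : A ↔ Fin k) where
  open Inverse A↔Fin using (to; from; strictlyInverseʳ)

  _≟_ : DecidableEquality A
  _≟_ = via-injection (↔⇒↣ A↔Fin) _≟ᶠ_

  anyLetter? : {P : A → Set} → Decidable P → Dec (∃ P)
  anyLetter? {P} P? = map′
    (λ (i , p) → from i , p)
    (λ (a , p) → to a , subst P (sym (strictlyInverseʳ a)) p)
    (any? (P? ∘ from))

  -- A word of length at most `suc N` is empty or a letter followed by a word of length at most `N`,
  -- and there are finitely many letters. Generality in `P` lets the recursion absorb the letters
  -- already chosen.
  anyShort? : ∀ N {P : Word A → Set} → Decidable P → Dec (∃[ w ] Short N w × P w)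
  anyShort? zero    P? = map′ (λ p → [] , z≤n , p) (λ where ([] , _ , p) → p) (P? [])
  anyShort? (suc N) P? = map′
    [ (λ p → [] , z≤n , p) , (λ (a , w , l , p) → a ∷ w , s≤s l , p) ]′
    (λ where
      ([]    , _     , p) → inj₁ p
      (a ∷ w , s≤s l , p) → inj₂ (a , w , l , p))
    (P? [] ⊎-dec anyLetter? λ a → anyShort? N (P? ∘ (a ∷_)))

  anyShorts? : ∀ n N {P : Vec (Word A) n → Set} → Decidable P →
               Dec (∃[ ρ ] All (Short N) ρ × P ρ)
  anyShorts? zero    N P? = map′ (λ p → [] , [] , p) (λ where ([] , _ , p) → p) (P? [])
  anyShorts? (suc n) N P? = map′
    (λ (w , l , ρ , ls , p) → w ∷ ρ , l ∷ ls , p)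
    (λ where (w ∷ ρ , l ∷ ls , p) → w , l , ρ , ls , p)
    (anyShort? N λ w → anyShorts? n N (P? ∘ (w ∷_)))

  L? : (β : Pattern A m) → Decidable (L β)
  L? {m = m} β w = map′
    (λ (ρ , _ , ρβ≡w) → Equivalence.from (∈L⇔eval β) (ρ , ρβ≡w))
    (λ w∈L → let ρ , ρβ≡w = Equivalence.to (∈L⇔eval β) w∈L in
      -- The bound `length w` suffices because `β` evaluates to `w` itself under `ρ`.
      truncate (length w) ρ , truncate-short (length w) ρ ,
      trans (eval-truncate (length w) ρ β (≤-reflexive (cong length ρβ≡w))) ρβ≡w)
    (anyShorts? m (length w) λ ρ → ≡-dec _≟_ (eval ρ β) w)

  inclusion⇔¬Holds : (α : Pattern A n) (β : Pattern A m) →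
                     (L α ⊆ L β) ⇔ (¬ Holds (inclusionSentence α β))
  inclusion⇔¬Holds α β = mk⇔
    (λ α⊆β holds →
      let ρ , ρα≢ = Equivalence.to (inclusionSentence⇔ α β) holds
          σ , σβ≡ρα = Equivalence.to (∈L⇔eval β) (α⊆β (toSubstitution ρ , refl))
      in ρα≢ σ (sym σβ≡ρα))
    -- If `w` were outside `L β`, an assignment sending `α` to `w` would be a witness for the
    -- existential block.
    (λ ¬holds {w} w∈Lα → decidable-stable (L? β w) λ w∉Lβ →
      let ρ , ρα≡w = Equivalence.to (∈L⇔eval α) w∈Lα
      in ¬holds (Equivalence.from (inclusionSentence⇔ α β) (ρ , λ σ ρα≡σβ →
           w∉Lβ (toSubstitution σ , trans (sym ρα≡σβ) ρα≡w))))

theorem3p4 : (A : Set) (k : ℕ) → A ↔ Fin k → ∃₂ (λ (a b : A) → a ≢ b) →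
    (n m : ℕ) (α : Pattern A n) (β : Pattern A m) →
    ((L α ⊆ L β) ⇔ (¬ Holds (inclusionSentence α β))) ×
    (Dec (Holds (inclusionSentence α β)) → Dec (L α ⊆ L β))
-- The reduction complements the answer: inclusion is decided by negating the verdict on the
-- sentence.
theorem3p4 A k A↔Fin _ n m α β = inclusion , λ holds? →
  map′ (Equivalence.from inclusion) (Equivalence.to inclusion) (¬? holds?)
  where
  inclusion : (L α ⊆ L β) ⇔ (¬ Holds (inclusionSentence α β))
  inclusion = inclusion⇔¬Holds A↔Fin α β
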